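{- Consider the translation of $\mathsf{CL}_{\rm b}$ to $\mathsf{CLL}_{\rm b}$ obtained by composing the Gödel-Gentzen translation $(\cdot)^{\rm G}$ with Girard's call-by-value translation $(\cdot)^*$, i.e. $A\mapsto(A^{\rm G})^*$. This composition can be presented directly in a modular (and simpler) way, i.e. for every formula $A$ of the language of $\mathsf{ILL}_\bot$ the formulas $(A^{\rm G})^*$ and $A^{{\rm G}*}$ are provably equivalent in $\mathsf{CLL}_{\rm b}$, where $A^{{\rm G}*}$ is defined inductively by: $P^{{\rm G}*}:=\,!?!P$ for $P$ atomic; $(A\otimes B)^{{\rm G}*}:=A^{{\rm G}*}\otimes B^{{\rm G}*}$; $(A\& B)^{{\rm G}*}:=\,!(A^{{\rm G}*}\& B^{{\rm G}*})$; $(A\oplus B)^{{\rm G}*}:=\,!?(A^{{\rm G}*}\oplus B^{{\rm G}*})$; $(A\multimap B)^{{\rm G}*}:=\,!(A^{{\rm G}*}\multimap B^{{\rm G}*})$; $(\forall xA)^{{\rm G}*}:=\,!\forall xA^{{\rm G}*}$; $(\exists xA)^{{\rm G}*}:=\,!?\exists xA^{{\rm G}*}$; $(!A)^{{\rm G}*}:=\,!A^{{\rm G}*}$.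
   Context: Intuitionistic linear logic $\mathsf{ILL}$ (first order). Formulas are built from atomic formulas, including the constants $1,\top,0$, using $\otimes,\&,\oplus,\multimap$, $\forall x,\exists x$ and $!$. Sequents are $\Gamma\vdash A$ with $\Gamma$ a finite multiset of formulas and exactly one formula on the right. Axioms: $A\vdash A$; $\vdash 1$; $\Gamma\vdash\top$; $\Gamma,0\vdash C$. Rules (premises $\Rightarrow$ conclusion): (cut) $\Gamma\vdash A;\ \Delta,A\vdash C\Rightarrow\Gamma,\Delta\vdash C$; $\Gamma\vdash C\Rightarrow\Gamma,1\vdash C$; $\Gamma\vdash A;\ \Delta\vdash B\Rightarrow\Gamma,\Delta\vdash A\otimes B$; $\Gamma,A,B\vdash C\Rightarrow\Gamma,A\otimes B\vdash C$; $\Gamma,A\vdash B\Rightarrow\Gamma\vdash A\multimap B$; $\Gamma\vdash A;\ \Delta,B\vdash C\Rightarrow\Gamma,\Delta,A\multimap B\vdash C$; $\Gamma\vdash A;\ \Gamma\vdash B\Rightarrow\Gamma\vdash A\& B$; $\Gamma,A\vdash C\Rightarrow\Gamma,A\& B\vdash C$; $\Gamma,B\vdash C\Rightarrow\Gamma,A\& B\vdash C$; $\Gamma\vdash A\Rightarrow\Gamma\vdash A\oplus B$; $\Gamma\vdash B\Rightarrow\Gamma\vdash A\oplus B$; $\Gamma,A\vdash C;\ \Gamma,B\vdash C\Rightarrow\Gamma,A\oplus B\vdash C$; $\Gamma\vdash A\Rightarrow\Gamma\vdash\forall xA$; $\Gamma,A[t/x]\vdash C\Rightarrow\Gamma,\forall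 xA\vdash C$; $\Gamma\vdash A[t/x]\Rightarrow\Gamma\vdash\exists xA$; $\Gamma,A\vdash C\Rightarrow\Gamma,\exists xA\vdash C$ (usual eigenvariable conditions); $\Gamma,!A,!A\vdash C\Rightarrow\Gamma,!A\vdash C$; $\Gamma\vdash C\Rightarrow\Gamma,!A\vdash C$; $!\Gamma\vdash A\Rightarrow\,!\Gamma\vdash\,!A$; $\Gamma,A\vdash C\Rightarrow\Gamma,!A\vdash C$. $\mathsf{ILL}_\bot$ extends $\mathsf{ILL}$ by one more constant $\bot$ (also counted as atomic); its sequents have at most one formula on the right (so $C$ in the rules above may be absent), and it has the additional axiom $\bot\vdash$ and rule $\Gamma\vdash\ \Rightarrow\Gamma\vdash\bot$. $\neg A:=A\multimap\bot$ and $?A:=\neg\,!\,\neg A$. $\mathsf{PRO}$: $A\vdash\,!A$; $\mathsf{DNE}$: $\neg\neg A\vdash A$ (axiom schemas). $\mathsf{CLL}_{\rm b}:=\mathsf{ILL}_\bot+\mathsf{DNE}$; $\mathsf{CL}_{\rm b}:=\mathsf{ILL}_\bot+\mathsf{PRO}+\mathsf{DNE}$. Formulas $A,B$ are provably equivalent in $S$ if $S$ proves $(A\multimap B)\&(B\multimap A)$. Gödel-Gentzen translation: $P^{\rm G}:=\neg\neg P$ ($P$ atomic); $(A\,\square\,B)^{\rm G}:=A^{\rm G}\,\square\,B^{\rm G}$ for $\square\in\{\otimes,\&,\multimap\}$; $(A\oplus B)^{\rm G}:=\neg\neg(A^{\rm G}\oplus B^{\rm G})$; $(\forall xA)^{\rm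 G}:=\forall xA^{\rm G}$; $(\exists xA)^{\rm G}:=\neg\neg\exists xA^{\rm G}$; $(!A)^{\rm G}:=\,!A^{\rm G}$. Call-by-value translation: $P^*:=\,!P$ ($P$ atomic, including $\bot$); $(A\otimes B)^*:=A^*\otimes B^*$; $(A\& B)^*:=\,!(A^*\& B^*)$; $(A\oplus B)^*:=A^*\oplus B^*$; $(A\multimap B)^*:=\,!(A^*\multimap B^*)$; $(\forall xA)^*:=\,!\forall xA^*$; $(\exists xA)^*:=\exists xA^*$; $(!A)^*:=\,!A^*$. -}

module Defs where

open import Data.List.Base using (List; []; _∷_; [_]; _++_; map)
open import Data.List.Relation.Binary.Permutation.Propositional using (_↭_)
open import Data.Maybe.Base as Maybe using (Maybe; just; nothing)
open import Data.Nat.Base using (ℕ; zero; suc)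
open import Data.Vec.Base using (Vec; []; _∷_)

record Signature : Set₁ where
  field
    Func      : Set
    funcArity : Func → ℕ
    Pred      : Set
    predArity : Pred → ℕ

open Signature public

-- Variables are de Bruijn indices ranging over all of ℕ (not scoped), so that
-- formulas may be open and there are always infinitely many variables.

data Term (L : Signature) : Set where
  var : ℕ → Term L
  fun : (f : Func L) → Vec (Term L) (funcArity L f) → Term L

-- The constants count as atomic, and the translations treat them as such.

data Atom (L : Signature) : Set where
  pred             : (p : Pred L) → Vec (Term L) (predArity L p) → Atom L
  one top zer bot  : Atom L

infixr 7 _⊗_ _&_ _⊕_
infixr 6 _⊸_
infix  8 !_ ∀′_ ∃′_

-- ∀′ and ∃′ bind index 0.

data Formula (L : Signature) : Set where
  atom            : Atom L → Formula L
  _⊗_ _&_ _⊕_ _⊸_ : Formula L → Formula L → Formula L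
  ∀′_ ∃′_ !_      : Formula L → Formula L

private variable
  L : Signature
  n : ℕ

𝟏 ⊤ 𝟎 ⊥ : Formula L
𝟏 = atom one
⊤ = atom top
𝟎 = atom zer
⊥ = atom bot

infix 8 ¬_ ⁇_

¬_ : Formula L → Formula L
¬ A = A ⊸ ⊥

⁇_ : Formula L → Formula L
⁇ A = ¬ ! ¬ A

Subst : Signature → Set
Subst L = ℕ → Term L

mutual
  substTerm : Subst L → Term L → Term L
  substTerm σ (var x)    = σ x
  substTerm σ (fun f ts) = fun f (substTerms σ ts)

  substTerms : Subst L → Vec (Term L) n → Vec (Term L) n
  substTerms σ []       = []
  substTerms σ (t ∷ ts) = substTerm σ t ∷ substTerms σ ts

shift : Subst L
shift x = var (suc x)

lift : Subst L → Subst L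
lift σ zero    = var zero
lift σ (suc x) = substTerm shift (σ x)

substAtom : Subst L → Atom L → Atom L
substAtom σ (pred p ts) = pred p (substTerms σ ts)
substAtom σ one         = one
substAtom σ top         = top
substAtom σ zer         = zer
substAtom σ bot         = bot

subst : Subst L → Formula L → Formula L
subst σ (atom P) = atom (substAtom σ P)
subst σ (A ⊗ B)  = subst σ A ⊗ subst σ B
subst σ (A & B)  = subst σ A & subst σ B
subst σ (A ⊕ B)  = subst σ A ⊕ subst σ B
subst σ (A ⊸ B)  = subst σ A ⊸ subst σ B
subst σ (∀′ A)   = ∀′ subst (lift σ) A
subst σ (∃′ A)   = ∃′ subst (lift σ) A
subst σ (! A)    = ! subst σ A

single : Term L → Subst L
single t zero    = t
single t (suc x) = var x

infix 9 _[_/0] _↑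

_[_/0] : Formula L → Term L → Formula L
A [ t /0] = subst (single t) A

_↑ : Formula L → Formula L
A ↑ = subst shift A

-- Antecedents are lists, made into multisets by the rule `exch`; the
-- succedent is `nothing` when there is no formula on the right.

Sequents : Signature → Set₁
Sequents L = List (Formula L) → Maybe (Formula L) → Set

infix 4 ILL⊥+_∶_⊢_

-- ILL⊥ extended by the sequents in Ax as additional axioms. The eigenvariable
-- conditions of ∀R and ∃L are expressed by shifting the side formulas, which
-- makes index 0 fresh for them.

data ILL⊥+_∶_⊢_ {L : Signature} (Ax : Sequents L) : Sequents L where
  axiom : ∀ {Γ C} → Ax Γ C → ILL⊥+ Ax ∶ Γ ⊢ C
  exch  : ∀ {Γ Δ C} → Γ ↭ Δ → ILL⊥+ Ax ∶ Γ ⊢ C → ILL⊥+ Ax ∶ Δ ⊢ C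

  id  : ∀ {A} → ILL⊥+ Ax ∶ [ A ] ⊢ just A
  cut : ∀ {Γ Δ A C} → ILL⊥+ Ax ∶ Γ ⊢ just A → ILL⊥+ Ax ∶ A ∷ Δ ⊢ C →
        ILL⊥+ Ax ∶ Γ ++ Δ ⊢ C

  𝟏R : ILL⊥+ Ax ∶ [] ⊢ just 𝟏
  𝟏L : ∀ {Γ C} → ILL⊥+ Ax ∶ Γ ⊢ C → ILL⊥+ Ax ∶ 𝟏 ∷ Γ ⊢ C
  ⊤R : ∀ {Γ} → ILL⊥+ Ax ∶ Γ ⊢ just ⊤
  𝟎L : ∀ {Γ C} → ILL⊥+ Ax ∶ 𝟎 ∷ Γ ⊢ C
  ⊥L : ILL⊥+ Ax ∶ [ ⊥ ] ⊢ nothing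
  ⊥R : ∀ {Γ} → ILL⊥+ Ax ∶ Γ ⊢ nothing → ILL⊥+ Ax ∶ Γ ⊢ just ⊥

  ⊗R : ∀ {Γ Δ A B} → ILL⊥+ Ax ∶ Γ ⊢ just A → ILL⊥+ Ax ∶ Δ ⊢ just B →
       ILL⊥+ Ax ∶ Γ ++ Δ ⊢ just (A ⊗ B)
  ⊗L : ∀ {Γ A B C} → ILL⊥+ Ax ∶ A ∷ B ∷ Γ ⊢ C → ILL⊥+ Ax ∶ A ⊗ B ∷ Γ ⊢ C

  ⊸R : ∀ {Γ A B} → ILL⊥+ Ax ∶ A ∷ Γ ⊢ just B → ILL⊥+ Ax ∶ Γ ⊢ just (A ⊸ B)
  ⊸L : ∀ {Γ Δ A B C} → ILL⊥+ Ax ∶ Γ ⊢ just A → ILL⊥+ Ax ∶ B ∷ Δ ⊢ C →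
       ILL⊥+ Ax ∶ A ⊸ B ∷ Γ ++ Δ ⊢ C

  &R  : ∀ {Γ A B} → ILL⊥+ Ax ∶ Γ ⊢ just A → ILL⊥+ Ax ∶ Γ ⊢ just B →
        ILL⊥+ Ax ∶ Γ ⊢ just (A & B)
  &L₁ : ∀ {Γ A B C} → ILL⊥+ Ax ∶ A ∷ Γ ⊢ C → ILL⊥+ Ax ∶ A & B ∷ Γ ⊢ C
  &L₂ : ∀ {Γ A B C} → ILL⊥+ Ax ∶ B ∷ Γ ⊢ C → ILL⊥+ Ax ∶ A & B ∷ Γ ⊢ C

  ⊕R₁ : ∀ {Γ A B} → ILL⊥+ Ax ∶ Γ ⊢ just A → ILL⊥+ Ax ∶ Γ ⊢ just (A ⊕ B)
  ⊕R₂ : ∀ {Γ A B} → ILL⊥+ Ax ∶ Γ ⊢ just B → ILL⊥+ Ax ∶ Γ ⊢ just (A ⊕ B)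
  ⊕L  : ∀ {Γ A B C} → ILL⊥+ Ax ∶ A ∷ Γ ⊢ C → ILL⊥+ Ax ∶ B ∷ Γ ⊢ C →
        ILL⊥+ Ax ∶ A ⊕ B ∷ Γ ⊢ C

  ∀R : ∀ {Γ A} → ILL⊥+ Ax ∶ map _↑ Γ ⊢ just A → ILL⊥+ Ax ∶ Γ ⊢ just (∀′ A)
  ∀L : ∀ {Γ A C} t → ILL⊥+ Ax ∶ A [ t /0] ∷ Γ ⊢ C → ILL⊥+ Ax ∶ ∀′ A ∷ Γ ⊢ C
  ∃R : ∀ {Γ A} t → ILL⊥+ Ax ∶ Γ ⊢ just (A [ t /0]) → ILL⊥+ Ax ∶ Γ ⊢ just (∃′ A)
  ∃L : ∀ {Γ A C} → ILL⊥+ Ax ∶ A ∷ map _↑ Γ ⊢ Maybe.map _↑ C →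
       ILL⊥+ Ax ∶ ∃′ A ∷ Γ ⊢ C

  !C : ∀ {Γ A C} → ILL⊥+ Ax ∶ ! A ∷ ! A ∷ Γ ⊢ C → ILL⊥+ Ax ∶ ! A ∷ Γ ⊢ C
  !W : ∀ {Γ A C} → ILL⊥+ Ax ∶ Γ ⊢ C → ILL⊥+ Ax ∶ ! A ∷ Γ ⊢ C
  !R : ∀ {Γ A} → ILL⊥+ Ax ∶ map !_ Γ ⊢ just A → ILL⊥+ Ax ∶ map !_ Γ ⊢ just (! A)
  !L : ∀ {Γ A C} → ILL⊥+ Ax ∶ A ∷ Γ ⊢ C → ILL⊥+ Ax ∶ ! A ∷ Γ ⊢ C

data DNE {L : Signature} : Sequents L where
  dne : ∀ A → DNE [ ¬ ¬ A ] (just A)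

CLLb : Sequents L
CLLb Γ C = ILL⊥+ DNE ∶ Γ ⊢ C

ProvablyEquivalent : Sequents L → Formula L → Formula L → Set
ProvablyEquivalent S A B = S [] (just ((A ⊸ B) & (B ⊸ A)))

infix 9 _ᴳ _* _ᴳ*

_ᴳ : Formula L → Formula L
(atom P) ᴳ = ¬ ¬ atom P
(A ⊗ B) ᴳ  = (A ᴳ) ⊗ (B ᴳ)
(A & B) ᴳ  = (A ᴳ) & (B ᴳ)
(A ⊕ B) ᴳ  = ¬ ¬ ((A ᴳ) ⊕ (B ᴳ))
(A ⊸ B) ᴳ  = (A ᴳ) ⊸ (B ᴳ)
(∀′ A) ᴳ   = ∀′ (A ᴳ)
(∃′ A) ᴳ   = ¬ ¬ ∃′ (A ᴳ)
(! A) ᴳ    = ! (A ᴳ)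

_* : Formula L → Formula L
(atom P) * = ! atom P
(A ⊗ B) *  = (A *) ⊗ (B *)
(A & B) *  = ! ((A *) & (B *))
(A ⊕ B) *  = (A *) ⊕ (B *)
(A ⊸ B) *  = ! ((A *) ⊸ (B *))
(∀′ A) *   = ! ∀′ (A *)
(∃′ A) *   = ∃′ (A *)
(! A) *    = ! (A *)

_ᴳ* : Formula L → Formula L
(atom P) ᴳ* = ! ⁇ ! atom P
(A ⊗ B) ᴳ*  = (A ᴳ*) ⊗ (B ᴳ*)
(A & B) ᴳ*  = ! ((A ᴳ*) & (B ᴳ*))
(A ⊕ B) ᴳ*  = ! ⁇ ((A ᴳ*) ⊕ (B ᴳ*))
(A ⊸ B) ᴳ*  = ! ((A ᴳ*) ⊸ (B ᴳ*))
(∀′ A) ᴳ*   = ! ∀′ (A ᴳ*)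
(∃′ A) ᴳ*   = ! ⁇ ∃′ (A ᴳ*)
(! A) ᴳ*    = ! (A ᴳ*)

{-# OPTIONS --safe #-}
-- The two translations differ only at the double negations, where (¬ ¬ X)* reads
-- ! (! (X* ⊸ ! ⊥) ⊸ ! ⊥) whereas the direct translation has ! ⁇ X*, that is,
-- ! (! (X* ⊸ ⊥) ⊸ ⊥).  The two agree because X* entails ! X* for every X:
-- a refutation of X* from banged hypotheses then uses banged hypotheses only,
-- so promotion strengthens its conclusion ⊥ to ! ⊥.  DNE is never invoked.
module Submission where

open import Defs
open import Data.List.Base using ([]; _∷_; [_])
open import Data.List.Relation.Binary.Permutation.Propositional using (↭-refl; ↭-swap)
open import Data.Maybe.Base using (just)
open import Data.Nat.Base using (zero; suc)
open import Data.Product.Base using (_×_; _,_)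
open import Data.Vec.Base using (Vec; []; _∷_)
open import Relation.Binary.PropositionalEquality
  using (_≡_; refl; sym; trans; cong; cong₂)
  renaming (subst to transport)

mutual
  lift-shift-term : ∀ {L} (σ : Subst L) t →
    substTerm (lift σ) (substTerm shift t) ≡ substTerm shift (substTerm σ t)
  lift-shift-term σ (var x)    = refl
  lift-shift-term σ (fun f ts) = cong (fun f) (lift-shift-terms σ ts)

  lift-shift-terms : ∀ {L n} (σ : Subst L) (ts : Vec (Term L) n) →
    substTerms (lift σ) (substTerms shift ts) ≡ substTerms shift (substTerms σ ts)
  lift-shift-terms σ []       = refl
  lift-shift-terms σ (t ∷ ts) = cong₂ _∷_ (lift-shift-term σ t) (lift-shift-terms σ ts)

infix 4 _RetractionOf_

-- Demanded on variables only, so that the condition can be carried under a binder by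
-- `lift-retraction`.
_RetractionOf_ : ∀ {L} → Subst L → Subst L → Set
σ RetractionOf τ = ∀ x → substTerm σ (τ x) ≡ var x

lift-retraction : ∀ {L} {σ τ : Subst L} → σ RetractionOf τ → lift σ RetractionOf lift τ
lift-retraction r zero = refl
lift-retraction {σ = σ} {τ} r (suc x) =
  trans (lift-shift-term σ (τ x)) (cong (substTerm shift) (r x))

mutual
  retract-term : ∀ {L} {σ τ : Subst L} → σ RetractionOf τ → ∀ t → substTerm σ (substTerm τ t) ≡ t
  retract-term r (var x)    = r x
  retract-term r (fun f ts) = cong (fun f) (retract-terms r ts)

  retract-terms : ∀ {L n} {σ τ : Subst L} → σ RetractionOf τ → (ts : Vec (Term L) n) →
    substTerms σ (substTerms τ ts) ≡ ts
  retract-terms r []       = refl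
  retract-terms r (t ∷ ts) = cong₂ _∷_ (retract-term r t) (retract-terms r ts)

retract-atom : ∀ {L} {σ τ : Subst L} → σ RetractionOf τ → ∀ P → substAtom σ (substAtom τ P) ≡ P
retract-atom r (pred p ts) = cong (pred p) (retract-terms r ts)
retract-atom r one         = refl
retract-atom r top         = refl
retract-atom r zer         = refl
retract-atom r bot         = refl

retract : ∀ {L} {σ τ : Subst L} → σ RetractionOf τ → ∀ A → subst σ (subst τ A) ≡ A
retract r (atom P) = cong atom (retract-atom r P)
retract r (A ⊗ B)  = cong₂ _⊗_ (retract r A) (retract r B)
retract r (A & B)  = cong₂ _&_ (retract r A) (retract r B)
retract r (A ⊕ B)  = cong₂ _⊕_ (retract r A) (retract r B)
retract r (A ⊸ B)  = cong₂ _⊸_ (retract r A) (retract r B)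
retract r (∀′ A)   = cong ∀′_ (retract (lift-retraction r) A)
retract r (∃′ A)   = cong ∃′_ (retract (lift-retraction r) A)
retract r (! A)    = cong !_ (retract r A)

-- Shifting `∀′ A` or `∃′ A` past an eigenvariable applies `lift shift` to the body; instantiating
-- at index 0, the eigenvariable itself, undoes this renaming.
instantiate-fresh : ∀ {L} (A : Formula L) → subst (lift shift) A [ var zero /0] ≡ A
instantiate-fresh = retract λ { zero → refl ; (suc x) → refl }

module _ {L : Signature} {Ax : Sequents L} where

  infix 4 _⟶_ _⟷_

  _⟶_ _⟷_ : Formula L → Formula L → Set
  A ⟶ B = ILL⊥+ Ax ∶ [ A ] ⊢ just B
  A ⟷ B = (A ⟶ B) × (B ⟶ A)

  private variable
    A A′ B B′ X : Formula L

  swap : ∀ {C} → ILL⊥+ Ax ∶ A ∷ B ∷ [] ⊢ C → ILL⊥+ Ax ∶ B ∷ A ∷ [] ⊢ C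
  swap = exch (↭-swap _ _ ↭-refl)

  ⟶-trans : A ⟶ B → B ⟶ X → A ⟶ X
  ⟶-trans d e = cut d e

  ⟷-trans : A ⟷ B → B ⟷ X → A ⟷ X
  ⟷-trans (d , d′) (e , e′) = ⟶-trans d e , ⟶-trans e′ d′

  !-mono : A ⟶ B → ! A ⟶ ! B
  !-mono {A} d = !R {Γ = [ A ]} (!L d)

  ⊗-mono : A ⟶ A′ → B ⟶ B′ → A ⊗ B ⟶ A′ ⊗ B′
  ⊗-mono d e = ⊗L (⊗R d e)

  &-mono : A ⟶ A′ → B ⟶ B′ → A & B ⟶ A′ & B′
  &-mono d e = &R (&L₁ d) (&L₂ e)

  ⊕-mono : A ⟶ A′ → B ⟶ B′ → A ⊕ B ⟶ A′ ⊕ B′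
  ⊕-mono d e = ⊕L (⊕R₁ d) (⊕R₂ e)

  ⊸-mono : A′ ⟶ A → B ⟶ B′ → A ⊸ B ⟶ A′ ⊸ B′
  ⊸-mono d e = ⊸R (swap (⊸L d e))

  -- Serves above an application of `∀R`, where the hypothesis stands shifted and the eigenvariable
  -- is the right instance; `∃-raise` is the dual for `∃L`.
  ∀-lower : ∀ A → (∀′ A) ↑ ⟶ A
  ∀-lower A = ∀L (var zero)
    (transport (_⟶ A) (sym (instantiate-fresh A)) id)

  ∃-raise : ∀ A → A ⟶ (∃′ A) ↑
  ∃-raise A = ∃R (var zero)
    (transport (A ⟶_) (sym (instantiate-fresh A)) id)

  ∀-mono : A ⟶ B → ∀′ A ⟶ ∀′ B
  ∀-mono {A} d = ∀R (⟶-trans (∀-lower A) d)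

  ∃-mono : A ⟶ B → ∃′ A ⟶ ∃′ B
  ∃-mono {B = B} d = ∃L (⟶-trans d (∃-raise B))

  ⁇-mono : A ⟶ B → ⁇ A ⟶ ⁇ B
  ⁇-mono d = ⊸-mono (!-mono (⊸-mono d id)) id

  digging : ! A ⟶ ! ! A
  digging {A} = !R {Γ = [ A ]} id

  -- Every `A *` is built by `⊗`, `⊕` and `∃′` from formulas that begin with `!`. The latter promote
  -- by `digging`, and the three connectives preserve the property.
  *-promote : ∀ A → A * ⟶ ! (A *)
  *-promote (atom P) = digging
  *-promote (A ⊗ B)  = ⟶-trans (⊗-mono (*-promote A) (*-promote B))
    -- With both factors already banged, the context has the form that `!R` requires.
    (⊗L (!R {Γ = A * ∷ B * ∷ []} (⊗R (!L id) (!L id))))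
  *-promote (A & B)  = digging
  *-promote (A ⊕ B)  = ⊕L (⟶-trans (*-promote A) (!-mono (⊕R₁ id)))
                          (⟶-trans (*-promote B) (!-mono (⊕R₂ id)))
  *-promote (A ⊸ B)  = digging
  *-promote (∀′ A)   = digging
  *-promote (∃′ A)   = ∃L (⟶-trans (*-promote A) (!-mono (∃-raise (A *))))
  *-promote (! A)    = digging

  -- For `X = A *` the left side is `(¬ ¬ A) *`. Passing from `! ⊥` to `⊥` is dereliction; each way
  -- back is a promotion.
  ¬¬-! : X ⟶ ! X → ! (! (X ⊸ ! ⊥) ⊸ ! ⊥) ⟷ ! ⁇ X
  ¬¬-! {X} promote = !-mono (⊸-mono strengthen (!L id)) , unrelax
    where
    strengthen : ! ¬ X ⟶ ! (X ⊸ ! ⊥)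
    -- Cutting with `promote` replaces the hypothesis `X` by `! X`; next to `! ¬ X` this allows the
    -- inner `!R` to yield `! ⊥`.
    strengthen = !R {Γ = [ ¬ X ]} (⊸R (cut promote
      (!R {Γ = X ∷ ¬ X ∷ []} (!L (swap (!L (⊸L {Δ = []} id id)))))))

    unrelax : ! ⁇ X ⟶ ! (! (X ⊸ ! ⊥) ⊸ ! ⊥)
    -- Both hypotheses begin with `!` here, so the goal `! ⊥` reduces to `⊥`, which `⁇ X` delivers
    -- from `! ¬ X`.
    unrelax = !R {Γ = [ ⁇ X ]} (⊸R (!R {Γ = (X ⊸ ! ⊥) ∷ ⁇ X ∷ []}
      (swap (!L (⊸L {Δ = []} (!-mono (⊸-mono id (!L id))) id)))))

  ¬¬-* : ∀ A → (¬ ¬ A) * ⟷ ! ⁇ (A *)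
  ¬¬-* A = ¬¬-! (*-promote A)

  ᴳ-*⟷ᴳ* : ∀ A → (A ᴳ) * ⟷ A ᴳ*
  ᴳ-*⟷ᴳ* (atom P) = ¬¬-* (atom P)
  ᴳ-*⟷ᴳ* (A ⊗ B) with ᴳ-*⟷ᴳ* A | ᴳ-*⟷ᴳ* B
  ... | a , a′ | b , b′ = ⊗-mono a b , ⊗-mono a′ b′
  ᴳ-*⟷ᴳ* (A & B) with ᴳ-*⟷ᴳ* A | ᴳ-*⟷ᴳ* B
  ... | a , a′ | b , b′ = !-mono (&-mono a b) , !-mono (&-mono a′ b′)
  ᴳ-*⟷ᴳ* (A ⊕ B) with ᴳ-*⟷ᴳ* A | ᴳ-*⟷ᴳ* B
  -- First the double negation becomes `! ⁇`, then the induction hypotheses act beneath it, where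
  -- `⁇` is covariant.
  ... | a , a′ | b , b′ = ⟷-trans (¬¬-* (A ᴳ ⊕ B ᴳ))
    (!-mono (⁇-mono (⊕-mono a b)) , !-mono (⁇-mono (⊕-mono a′ b′)))
  ᴳ-*⟷ᴳ* (A ⊸ B) with ᴳ-*⟷ᴳ* A | ᴳ-*⟷ᴳ* B
  -- The antecedent is contravariant, so each direction uses the opposite half of its equivalence;
  -- hence the induction carries both halves together.
  ... | a , a′ | b , b′ = !-mono (⊸-mono a′ b) , !-mono (⊸-mono a b′)
  ᴳ-*⟷ᴳ* (∀′ A) with ᴳ-*⟷ᴳ* A
  ... | a , a′ = !-mono (∀-mono a) , !-mono (∀-mono a′)
  ᴳ-*⟷ᴳ* (∃′ A) with ᴳ-*⟷ᴳ* A
  ... | a , a′ = ⟷-trans (¬¬-* (∃′ A ᴳ))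
    (!-mono (⁇-mono (∃-mono a)) , !-mono (⁇-mono (∃-mono a′)))
  ᴳ-*⟷ᴳ* (! A) with ᴳ-*⟷ᴳ* A
  ... | a , a′ = !-mono a , !-mono a′

  ⟷⇒ProvablyEquivalent : A ⟷ B → ProvablyEquivalent (ILL⊥+_∶_⊢_ Ax) A B
  ⟷⇒ProvablyEquivalent (d , d′) = &R (⊸R d) (⊸R d′)

theorem2 : (L : Signature) (A : Formula L) →
    ProvablyEquivalent CLLb ((A ᴳ) *) (A ᴳ*)
theorem2 L A = ⟷⇒ProvablyEquivalent (ᴳ-*⟷ᴳ* A)
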